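{- Let $\overrightarrow{W}$ be a Morse sequence on a simplicial complex $K$. Then for every $p$, $\partial_p\circ\widetilde{\curlywedge}_p=\widetilde{\curlywedge}_{p-1}\circ\widehat{\partial}_p$ and $\delta_p\circ\widetilde{\curlyvee}_p=\widetilde{\curlyvee}_{p+1}\circ\widehat{\delta}_p$ as maps on $\widehat W[p]$.
   Context: A simplicial complex $K$ is a finite collection of non-empty finite sets closed under taking non-empty subsets; $\dim\sigma=|\sigma|-1$, $K^{(p)}$ the set of $p$-simplices. A pair $(\sigma,\tau)$ with $\sigma\subsetneq\tau$ is a free pair for $K$ if $\tau$ is the only simplex other than $\sigma$ containing $\sigma$; $K$ is then an elementary expansion of $K\setminus\{\sigma,\tau\}$. If $\nu$ is a facet (maximal simplex) of $K$, $K$ is an elementary filling of $K\setminus\{\nu\}$. A Morse sequence on $K$ is a sequence $\langle\emptyset=K_0,\dots,K_k=K\rangle$ with each $K_i$ an elementary expansion or filling of $K_{i-1}$; simplices added by fillings are critical; for an expansion $K_i=K_{i-1}\cup\{\sigma,\tau\}$, $\sigma\subset\tau$, $\sigma$ is lower regular and $\tau$ upper regular. $\widehat W$ is the set of critical simplices. $K[p]$ is the $\mathbb{Z}_2$-vector space of subsets of $K^{(p)}$ (sum = symmetric difference, $0=\emptyset$), $\widehat W[p]=\{c\in K[p]:c\subseteq\widehat W\}$. For $\sigma\in K^{(p)}$, $\partial(\sigma)=\{\tau\in K^{(p-1)}:\tau\subset\sigma\}$, $\delta(\sigma)=\{\tau\in K^{(p+1)}:\sigma\subset\tau\}$, with linear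 extensions $\partial_p:K[p]\to K[p-1]$, $\delta_p:K[p]\to K[p+1]$. The reference map $\curlywedge$ is the unique map assigning to each $p$-simplex an element of $\widehat W[p]$, extended linearly, with $\curlywedge(\nu)=\{\nu\}$ for critical $\nu$ and $\curlywedge(\tau)=0=\curlywedge(\partial(\tau))$ for upper regular $\tau$; the coreference map $\curlyvee$ is the unique such map with $\curlyvee(\nu)=\{\nu\}$ for critical $\nu$ and $\curlyvee(\sigma)=0=\curlyvee(\delta(\sigma))$ for lower regular $\sigma$. $\widehat\partial_p:\widehat W[p]\to\widehat W[p-1]$, $\widehat\partial_p(c)=\curlywedge(\partial_p(c))$, and $\widehat\delta_p:\widehat W[p]\to\widehat W[p+1]$, $\widehat\delta_p(c)=\curlyvee(\delta_p(c))$. The extension map $\widetilde\curlywedge_p:\widehat W[p]\to K[p]$ and coextension map $\widetilde\curlyvee_p:\widehat W[p]\to K[p]$ are the linear maps with $\widetilde\curlywedge(\kappa)=\{\nu\in K:\kappa\in\curlyvee(\nu)\}$ and $\widetilde\curlyvee(\kappa)=\{\nu\in K:\kappa\in\curlywedge(\nu)\}$ for critical $p$-simplices $\kappa$. -}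

module Defs where

open import Data.Bool.Base using (Bool; true; false; _∧_; _xor_; T)
open import Data.Fin.Subset using (Subset; inside; outside; Nonempty; _⊆_; _⊂_; ∣_∣)
open import Data.Fin.Subset.Properties using (_⊂?_)
open import Data.Integer.Base using (ℤ; +_; _+_; _-_; 1ℤ)
import Data.Integer.Properties as ℤ
open import Data.List.Base using (List; []; _∷_; _++_; map; mapMaybe; foldr)
open import Data.Maybe.Base as Maybe using (Maybe)
open import Data.Nat.Base using (ℕ; zero; suc)
open import Data.Product.Base using (_×_; _,_)
import Data.Vec.Base as Vec
open import Data.Vec.Properties using (≡-dec)
import Data.Bool.Properties as Bool
open import Function.Bundles using (module Equivalence)
open import Level using (0ℓ)
import Level
open import Relation.Binary.PropositionalEquality using (_≡_; _≢_; _≗_)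
open import Relation.Nullary.Decidable using (⌊_⌋; dec⇒maybe; _×-dec_)
open import Relation.Unary using (Pred; Decidable; Empty; _∈_; _≐_; _∪_; _∖_; ｛_｝; ∅)

private
  variable
    n : ℕ

-- The vertices of a finite complex are numbered by Fin n; not every element of
-- Fin n has to be a vertex.
record Complex (n : ℕ) : Set (Level.suc 0ℓ) where
  field
    Face     : Pred (Subset n) 0ℓ
    face?    : Decidable Face
    nonempty : ∀ {σ} → σ ∈ Face → Nonempty σ
    closed   : ∀ {σ τ} → Nonempty σ → σ ⊆ τ → τ ∈ Face → σ ∈ Face

open Complex public

-- Integer valued, so that p - 1 makes sense for every p; K⁽ᵖ⁾ is empty for p < 0.
dim : Subset n → ℤ
dim σ = + ∣ σ ∣ - 1ℤ

record FreePair (K : Complex n) (σ τ : Subset n) : Set where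
  field
    lower∈K : σ ∈ Face K
    upper∈K : τ ∈ Face K
    proper  : σ ⊂ τ
    only    : ∀ {ρ} → ρ ∈ Face K → ρ ≢ σ → σ ⊆ ρ → ρ ≡ τ

record Facet (K : Complex n) (ν : Subset n) : Set where
  field
    facet∈K : ν ∈ Face K
    maximal : ∀ {ρ} → ρ ∈ Face K → ν ⊆ ρ → ρ ≡ ν

ElementaryExpansion : (L K : Complex n) (σ τ : Subset n) → Set
ElementaryExpansion L K σ τ = FreePair K σ τ × Face L ≐ Face K ∖ (｛ σ ｝ ∪ ｛ τ ｝)

ElementaryFilling : (L K : Complex n) (ν : Subset n) → Set
ElementaryFilling L K ν = Facet K ν × Face L ≐ Face K ∖ ｛ ν ｝

-- A sequence ⟨∅ = K₀, …, Kₖ = K⟩, indexed by its last complex.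
data MorseSequence {n : ℕ} : Complex n → Set (Level.suc 0ℓ) where
  start  : ∀ {K} → Empty (Face K) → MorseSequence K
  expand : ∀ {L K} → MorseSequence L → (σ τ : Subset n) →
           ElementaryExpansion L K σ τ → MorseSequence K
  fill   : ∀ {L K} → MorseSequence L → (ν : Subset n) →
           ElementaryFilling L K ν → MorseSequence K

Critical : {K : Complex n} → MorseSequence K → Pred (Subset n) 0ℓ
Critical (start _)        = ∅
Critical (expand W _ _ _) = Critical W
Critical (fill W ν _)     = Critical W ∪ ｛ ν ｝

LowerRegular : {K : Complex n} → MorseSequence K → Pred (Subset n) 0ℓ
LowerRegular (start _)        = ∅
LowerRegular (expand W σ _ _) = LowerRegular W ∪ ｛ σ ｝
LowerRegular (fill W _ _)     = LowerRegular W

UpperRegular : {K : Complex n} → MorseSequence K → Pred (Subset n) 0ℓ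
UpperRegular (start _)        = ∅
UpperRegular (expand W _ τ _) = UpperRegular W ∪ ｛ τ ｝
UpperRegular (fill W _ _)     = UpperRegular W

-- K⁽ᵖ⁾.  The proofs are irrelevant, so a simplex is determined by its vertex set.
record Simplex (K : Complex n) (p : ℤ) : Set where
  constructor simplex
  field
    verts   : Subset n
    .isFace : verts ∈ Face K
    .hasDim : dim verts ≡ p

open Simplex public using (verts)

subsets : ∀ n → List (Subset n)
subsets zero    = Vec.[] ∷ []
subsets (suc n) = map (outside Vec.∷_) (subsets n) ++ map (inside Vec.∷_) (subsets n)

simplices : (K : Complex n) (p : ℤ) → List (Simplex K p)
simplices {n} K p = mapMaybe asSimplex (subsets n)
  where
  asSimplex : Subset n → Maybe (Simplex K p)
  asSimplex σ = Maybe.map (λ (σ∈K , d) → simplex σ σ∈K d) (dec⇒maybe (face? K σ ×-dec dim σ ℤ.≟ p))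

-- K[p]: subsets of K⁽ᵖ⁾ given by characteristic functions, compared with _≗_.
-- The sum of the ℤ₂-vector space is pointwise _xor_.
Chain : Complex n → ℤ → Set
Chain K p = Simplex K p → Bool

module _ {K : Complex n} where

  𝟘 : ∀ {p} → Chain K p
  𝟘 _ = false

  ⟦_⟧ : ∀ {p} → Simplex K p → Chain K p
  ⟦ ν ⟧ κ = ⌊ ≡-dec Bool._≟_ (verts κ) (verts ν) ⌋

  -- The linear extension c ↦ Σ_{σ ∈ c} f(σ).
  linear : ∀ {p q} → (Simplex K p → Chain K q) → Chain K p → Chain K q
  linear {p} f c τ = foldr _xor_ false (map (λ σ → c σ ∧ f σ τ) (simplices K p))

  boundary : ∀ {p} → Simplex K p → Chain K (p - 1ℤ)
  boundary σ τ = ⌊ verts τ ⊂? verts σ ⌋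

  coboundary : ∀ {p} → Simplex K p → Chain K (p + 1ℤ)
  coboundary σ τ = ⌊ verts σ ⊂? verts τ ⌋

  ∂ : ∀ p → Chain K p → Chain K (p - 1ℤ)
  ∂ p = linear boundary

  δ : ∀ p → Chain K p → Chain K (p + 1ℤ)
  δ p = linear coboundary

module _ {K : Complex n} (W : MorseSequence K) where

  -- Ŵ[p]
  record CriticalChain (p : ℤ) : Set where
    constructor criticalChain
    field
      chain    : Chain K p
      critical : ∀ κ → T (chain κ) → verts κ ∈ Critical W

open CriticalChain public

module _ {K : Complex n} {W : MorseSequence K} where

  linearᶜ : ∀ {p q} → (Simplex K p → CriticalChain W q) → Chain K p → CriticalChain W q
  linearᶜ {p} f c = criticalChain (linear (λ σ → chain (f σ)) c) λ κ → go κ (simplices K p)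
    where
    go : ∀ κ σs → T (foldr _xor_ false (map (λ σ → c σ ∧ chain (f σ) κ) σs)) →
         verts κ ∈ Critical W
    go κ (σ ∷ σs) t with c σ | chain (f σ) κ in eq
    ... | false | _     = go κ σs t
    ... | true  | false = go κ σs t
    ... | true  | true  = critical (f σ) κ (Equivalence.from Bool.T-≡ eq)

module _ {K : Complex n} (W : MorseSequence K) where

  -- The defining properties of ⋏ and ⋎ determine these maps uniquely.
  record ReferenceMap : Set where
    field
      ref : ∀ {p} → Simplex K p → CriticalChain W p
      ref-critical : ∀ {p} (ν : Simplex K p) → verts ν ∈ Critical W →
                     chain (ref ν) ≗ ⟦ ν ⟧
      ref-upper    : ∀ {p} (τ : Simplex K p) → verts τ ∈ UpperRegular W →
                     chain (ref τ) ≗ 𝟘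
      ref-∂-upper  : ∀ {p} (τ : Simplex K p) → verts τ ∈ UpperRegular W →
                     chain (linearᶜ ref (boundary τ)) ≗ 𝟘

  record CoreferenceMap : Set where
    field
      coref : ∀ {p} → Simplex K p → CriticalChain W p
      coref-critical : ∀ {p} (ν : Simplex K p) → verts ν ∈ Critical W →
                       chain (coref ν) ≗ ⟦ ν ⟧
      coref-lower    : ∀ {p} (σ : Simplex K p) → verts σ ∈ LowerRegular W →
                       chain (coref σ) ≗ 𝟘
      coref-δ-lower  : ∀ {p} (σ : Simplex K p) → verts σ ∈ LowerRegular W →
                       chain (linearᶜ coref (coboundary σ)) ≗ 𝟘

open ReferenceMap public
open CoreferenceMap public

module _ {K : Complex n} {W : MorseSequence K} where

  ∂̂ : ReferenceMap W → ∀ p → CriticalChain W p → CriticalChain W (p - 1ℤ)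
  ∂̂ ⋏ p c = linearᶜ (ref ⋏) (∂ p (chain c))

  δ̂ : CoreferenceMap W → ∀ p → CriticalChain W p → CriticalChain W (p + 1ℤ)
  δ̂ ⋎ p c = linearᶜ (coref ⋎) (δ p (chain c))

  -- The extension map ⋏̃, with ⋏̃(κ) = {ν ∈ K : κ ∈ ⋎(ν)}.
  extension : CoreferenceMap W → ∀ p → CriticalChain W p → Chain K p
  extension ⋎ p c = linear (λ κ ν → chain (coref ⋎ ν) κ) (chain c)

  -- The coextension map ⋎̃, with ⋎̃(κ) = {ν ∈ K : κ ∈ ⋏(ν)}.
  coextension : ReferenceMap W → ∀ p → CriticalChain W p → Chain K p
  coextension ⋏ p c = linear (λ κ ν → chain (ref ⋏ ν) κ) (chain c)

{-# OPTIONS --safe #-}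
module Submission where

-- Write E for the transpose of ⋎ and R for ⋏. For critical c, x = ∂Ec contains no
-- lower regular simplex because ⋎ ∘ δ vanishes on those, and neither does ∂x = 0.
-- A chain with these two properties is E of its critical part, which is Rx: the
-- difference z = x - ERx is supported on upper regular simplices while ∂z misses
-- the lower regular ones, so z = 0, as one sees by undoing the expansions from the
-- last one on. Finally Ec - c is supported on upper regular simplices, on which
-- R ∘ ∂ vanishes, so Rx = R∂c. The second identity is dual.

open import Defs
open import Algebra.Bundles using (CommutativeRing)
open import Data.Bool.Base using (Bool; true; false; _∧_; _xor_)
import Data.Bool.Properties as Bool
open import Data.Bool.Properties using (∧-comm; ∧-assoc; ∧-zeroʳ; ∧-distribˡ-xor; ∧-distribʳ-xor; xor-assoc; xor-same; xor-identityʳ; xor-∧-commutativeRing; ¬-not)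
open import Algebra.Properties.CommutativeSemigroup (CommutativeRing.+-commutativeSemigroup xor-∧-commutativeRing) using (interchange)
open import Data.Fin.Base using (Fin; zero; suc)
open import Data.Fin.Subset using (Subset; inside; outside; _⊆_; _⊂_; ∣_∣; ⁅_⁆) renaming (_∈_ to _∈ₛ_; _∉_ to _∉ₛ_; _∪_ to _∪ₛ_)
open import Data.Fin.Subset.Properties using (_⊂?_; _⊆?_; _∈?_; ⊆-antisym; ⊆-refl; ⊂-trans; ⊂-irref; p⊂q⇒∣p∣<∣q∣; drop-∷-⊂; p⊆p∪q; q⊆p∪q; x∈p∪q⁻; x∈⁅x⁆; x∈⁅y⁆⇒x≡y; ∪-identityʳ)
open import Data.Integer.Base using (ℤ; +_; _+_; _-_; 1ℤ; -1ℤ)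
import Data.Integer.Properties as ℤ
open import Data.List.Base using (List; []; _∷_; _++_; map; mapMaybe; foldr)
open import Data.Maybe.Base as Maybe using (Maybe; just; nothing; maybe′)
open import Data.Nat.Base as ℕ using (ℕ; zero; suc)
import Data.Nat.Properties as ℕ
open import Data.Product.Base using (_×_; _,_; proj₁; proj₂)
open import Data.Sum.Base using (_⊎_; inj₁; inj₂; [_,_]′; map₂; swap)
open import Data.Vec.Base using ([]; _∷_; here; there)
open import Data.Vec.Properties using (≡-dec; ∷-injectiveʳ)
open import Function.Base using (_∘_)
open import Function.Bundles using (Equivalence)
open import Level using (0ℓ)
open import Relation.Binary.Definitions using (DecidableEquality)
open import Relation.Binary.PropositionalEquality using (_≡_; _≢_; _≗_; refl; sym; trans; cong; cong₂; subst; module ≡-Reasoning)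
open import Relation.Nullary using (Dec; yes; no; does; contradiction)
open import Relation.Nullary.Decidable using (⌊_⌋; dec⇒maybe; _×-dec_; recompute; isYes≗does; dec-true; dec-false)
open import Relation.Unary using (Pred; _∈_)

private
  variable
    n : ℕ
    A B : Set

-- Arithmetic modulo 2

∧-vanish : ∀ {b c} → (b ≡ true → c ≡ false) → b ∧ c ≡ false
∧-vanish {false} _ = refl
∧-vanish {true}  h = h refl

xor≡false⇒≡ : ∀ {b c} → b xor c ≡ false → b ≡ c
xor≡false⇒≡ {false} {false} _ = refl
xor≡false⇒≡ {true}  {true}  _ = refl

false-if-true : ∀ {b} → (b ≡ true → b ≡ false) → b ≡ false
false-if-true {false} _ = refl
false-if-true {true}  h = h refl

⌊⌋-true : (a? : Dec A) → A → ⌊ a? ⌋ ≡ true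
⌊⌋-true a? a = trans (isYes≗does a?) (dec-true a? a)

⌊⌋-true⁻ : (a? : Dec A) → ⌊ a? ⌋ ≡ true → A
⌊⌋-true⁻ (yes a) _ = a

∑ : List A → (A → Bool) → Bool
∑ xs f = foldr _xor_ false (map f xs)

∑-cong : ∀ (xs : List A) {f g : A → Bool} → f ≗ g → ∑ xs f ≡ ∑ xs g
∑-cong []       f≗g = refl
∑-cong (x ∷ xs) f≗g = cong₂ _xor_ (f≗g x) (∑-cong xs f≗g)

∑-zero : ∀ (xs : List A) {f : A → Bool} → (∀ x → f x ≡ false) → ∑ xs f ≡ false
∑-zero []       f≗0 = refl
∑-zero (x ∷ xs) f≗0 rewrite f≗0 x = ∑-zero xs f≗0

∑-xor : ∀ (xs : List A) (f g : A → Bool) → ∑ xs (λ x → f x xor g x) ≡ ∑ xs f xor ∑ xs g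
∑-xor []       f g = refl
∑-xor (x ∷ xs) f g = trans (cong ((f x xor g x) xor_) (∑-xor xs f g)) (interchange (f x) (g x) (∑ xs f) (∑ xs g))

∑-∧ˡ : ∀ (xs : List A) b (f : A → Bool) → ∑ xs (λ x → b ∧ f x) ≡ b ∧ ∑ xs f
∑-∧ˡ []       b f = sym (∧-zeroʳ b)
∑-∧ˡ (x ∷ xs) b f = trans (cong ((b ∧ f x) xor_) (∑-∧ˡ xs b f)) (sym (∧-distribˡ-xor b (f x) (∑ xs f)))

∑-∧ʳ : ∀ (xs : List A) b (f : A → Bool) → ∑ xs (λ x → f x ∧ b) ≡ ∑ xs f ∧ b
∑-∧ʳ xs b f = trans (∑-cong xs (λ x → ∧-comm (f x) b)) (trans (∑-∧ˡ xs b f) (∧-comm b _))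

∑-comm : ∀ (xs : List A) (ys : List B) (f : A → B → Bool) →
         ∑ xs (λ x → ∑ ys (f x)) ≡ ∑ ys (λ y → ∑ xs (λ x → f x y))
∑-comm []       ys f = sym (∑-zero ys (λ _ → refl))
∑-comm (x ∷ xs) ys f = trans (cong (∑ ys (f x) xor_) (∑-comm xs ys f)) (sym (∑-xor ys (f x) (λ y → ∑ xs (λ x → f x y))))

∑-++ : ∀ (xs ys : List A) (f : A → Bool) → ∑ (xs ++ ys) f ≡ ∑ xs f xor ∑ ys f
∑-++ []       ys f = refl
∑-++ (x ∷ xs) ys f = trans (cong (f x xor_) (∑-++ xs ys f)) (sym (xor-assoc (f x) _ _))

∑-map : ∀ (h : A → B) (xs : List A) (f : B → Bool) → ∑ (map h xs) f ≡ ∑ xs (f ∘ h)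
∑-map h []       f = refl
∑-map h (x ∷ xs) f = cong (f (h x) xor_) (∑-map h xs f)

∑-mapMaybe : ∀ (h : A → Maybe B) (xs : List A) (f : B → Bool) →
             ∑ (mapMaybe h xs) f ≡ ∑ xs (λ x → maybe′ f false (h x))
∑-mapMaybe h []       f = refl
∑-mapMaybe h (x ∷ xs) f with h x
... | just y  = cong (f y xor_) (∑-mapMaybe h xs f)
... | nothing = ∑-mapMaybe h xs f

-- Sums over subsets

∑-subsets-suc : ∀ (f : Subset (suc n) → Bool) →
  ∑ (subsets (suc n)) f ≡ ∑ (subsets n) (λ τ → f (outside ∷ τ)) xor ∑ (subsets n) (λ τ → f (inside ∷ τ))
∑-subsets-suc {n} f = trans (∑-++ (map (outside ∷_) (subsets n)) _ f)
  (cong₂ _xor_ (∑-map _ (subsets n) f) (∑-map _ (subsets n) f))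

∑-subsets-single : ∀ {n} (f : Subset n → Bool) ρ → (∀ τ → τ ≢ ρ → f τ ≡ false) → ∑ (subsets n) f ≡ f ρ
∑-subsets-single {zero}  f []            off = xor-identityʳ (f [])
∑-subsets-single {suc n} f (outside ∷ ρ) off = begin
  ∑ (subsets (suc n)) f ≡⟨ ∑-subsets-suc f ⟩
  _                     ≡⟨ cong₂ _xor_ (∑-subsets-single _ ρ (λ τ τ≢ρ → off _ (τ≢ρ ∘ ∷-injectiveʳ)))
                                       (∑-zero (subsets n) (λ τ → off _ (λ ()))) ⟩
  _                     ≡⟨ xor-identityʳ _ ⟩
  f (outside ∷ ρ)       ∎
  where open ≡-Reasoning
∑-subsets-single {suc n} f (inside ∷ ρ) off = begin
  ∑ (subsets (suc n)) f ≡⟨ ∑-subsets-suc f ⟩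
  _                     ≡⟨ cong₂ _xor_ (∑-zero (subsets n) (λ τ → off _ (λ ())))
                                       (∑-subsets-single _ ρ (λ τ τ≢ρ → off _ (τ≢ρ ∘ ∷-injectiveʳ))) ⟩
  f (inside ∷ ρ)        ∎
  where open ≡-Reasoning

-- At a vertex in ρ or outside σ only one choice for τ survives, and the induction continues. At the
-- first vertex of σ outside ρ both choices leave the same sum, which cancels against itself.
∑-interval-even : ∀ {n} (ρ σ : Subset n) → ρ ⊂ σ →
                  ∑ (subsets n) (λ τ → does (ρ ⊆? τ) ∧ does (τ ⊆? σ)) ≡ false
∑-interval-even [] [] (_ , () , _)
∑-interval-even {suc n} (outside ∷ ρ) (outside ∷ σ) ρ⊂σ = trans (∑-subsets-suc {n} _)
  (cong₂ _xor_ (∑-interval-even ρ σ (drop-∷-⊂ ρ⊂σ)) (∑-zero (subsets n) (λ τ → ∧-zeroʳ _)))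
∑-interval-even {suc n} (outside ∷ ρ) (inside ∷ σ) ρ⊂σ = trans (∑-subsets-suc {n} _)
  (xor-same (∑ (subsets n) (λ τ → does (ρ ⊆? τ) ∧ does (τ ⊆? σ))))
∑-interval-even {suc n} (inside ∷ ρ) (outside ∷ σ) (ρ⊆σ , _) = contradiction (ρ⊆σ here) (λ ())
∑-interval-even {suc n} (inside ∷ ρ) (inside ∷ σ) ρ⊂σ = trans (∑-subsets-suc {n} _)
  (cong₂ _xor_ (∑-zero (subsets n) (λ τ → refl)) (∑-interval-even ρ σ (drop-∷-⊂ ρ⊂σ)))

_≟ₛ_ : DecidableEquality (Subset n)
_≟ₛ_ = ≡-dec Bool._≟_

⊆∧≢⇒⊂ : {ρ τ : Subset n} → ρ ⊆ τ → ρ ≢ τ → ρ ⊂ τ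
⊆∧≢⇒⊂ {ρ = ρ} {τ} ρ⊆τ ρ≢τ with ρ ⊂? τ
... | yes ρ⊂τ = ρ⊂τ
... | no  ρ⊄τ = contradiction (⊆-antisym ρ⊆τ τ⊆ρ) ρ≢τ
  where
  τ⊆ρ : τ ⊆ ρ
  τ⊆ρ {x} x∈τ with x ∈? ρ
  ... | yes x∈ρ = x∈ρ
  ... | no  x∉ρ = contradiction ((λ {_} → ρ⊆τ) , x , x∈τ , x∉ρ) ρ⊄τ

⊂?≡⊆? : (ρ τ : Subset n) → ρ ≢ τ → ⌊ ρ ⊂? τ ⌋ ≡ does (ρ ⊆? τ)
⊂?≡⊆? ρ τ ρ≢τ with ρ ⊂? τ
... | yes ρ⊂τ = sym (dec-true (ρ ⊆? τ) (proj₁ ρ⊂τ))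
... | no  ρ⊄τ = sym (dec-false (ρ ⊆? τ) (λ ρ⊆τ → ρ⊄τ (⊆∧≢⇒⊂ ρ⊆τ ρ≢τ)))

⊂?-irrefl : (ρ : Subset n) → ⌊ ρ ⊂? ρ ⌋ ≡ false
⊂?-irrefl ρ = trans (isYes≗does (ρ ⊂? ρ)) (dec-false (ρ ⊂? ρ) (⊂-irref refl))

-- The endpoints are distinct, so adding both indicators modulo 2 removes each of them from the
-- closed interval.
open-interval : {ρ σ : Subset n} → ρ ⊂ σ → ∀ τ →
  ⌊ ρ ⊂? τ ⌋ ∧ ⌊ τ ⊂? σ ⌋ ≡ (does (ρ ⊆? τ) ∧ does (τ ⊆? σ)) xor (does (τ ≟ₛ ρ) xor does (τ ≟ₛ σ))
open-interval {ρ = ρ} {σ} ρ⊂σ τ with τ ≟ₛ ρ | τ ≟ₛ σ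
... | yes refl | yes refl = contradiction ρ⊂σ (⊂-irref refl)
... | yes refl | no τ≢σ
  rewrite ⊂?-irrefl τ | dec-true (τ ⊆? τ) ⊆-refl | dec-true (τ ⊆? σ) (proj₁ ρ⊂σ) = refl
... | no τ≢ρ | yes refl
  rewrite ⊂?-irrefl τ | dec-true (τ ⊆? τ) ⊆-refl | dec-true (ρ ⊆? τ) (proj₁ ρ⊂σ) = ∧-zeroʳ _
... | no τ≢ρ | no τ≢σ
  rewrite ⊂?≡⊆? ρ τ (τ≢ρ ∘ sym) | ⊂?≡⊆? τ σ τ≢σ = sym (xor-identityʳ _)

-- Taking two endpoints from an even interval keeps the parity; if ρ ⊂ σ fails, transitivity makes
-- the interval empty. When σ has two more vertices than ρ, this is the cancellation behind ∂∂ = 0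
-- and δδ = 0.
∑-open-interval-even : (ρ σ : Subset n) → ∑ (subsets n) (λ τ → ⌊ ρ ⊂? τ ⌋ ∧ ⌊ τ ⊂? σ ⌋) ≡ false
∑-open-interval-even {n} ρ σ with ρ ⊂? σ
... | no ρ⊄σ = ∑-zero (subsets n) λ τ → ∧-vanish λ ρ⊂τ → ¬-not λ τ⊂σ →
  ρ⊄σ (⊂-trans (⌊⌋-true⁻ (ρ ⊂? τ) ρ⊂τ) (⌊⌋-true⁻ (τ ⊂? σ) τ⊂σ))
... | yes ρ⊂σ = begin
  ∑ (subsets n) (λ τ → ⌊ ρ ⊂? τ ⌋ ∧ ⌊ τ ⊂? σ ⌋) ≡⟨ ∑-cong (subsets n) (open-interval ρ⊂σ) ⟩
  _ ≡⟨ ∑-xor (subsets n) _ _ ⟩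
  _ ≡⟨ cong₂ _xor_ (∑-interval-even ρ σ ρ⊂σ) (∑-xor (subsets n) _ _) ⟩
  _ ≡⟨ cong₂ _xor_ (∑-point ρ) (∑-point σ) ⟩
  false ∎
  where
  open ≡-Reasoning
  ∑-point : ∀ ρ → ∑ (subsets n) (λ τ → does (τ ≟ₛ ρ)) ≡ true
  ∑-point ρ = trans (∑-subsets-single _ ρ (λ τ → dec-false (τ ≟ₛ ρ))) (dec-true (ρ ≟ₛ ρ) refl)

-- Sums over simplices

module _ {K : Complex n} {p : ℤ} where

  -- Spelled like the local `asSimplex` in `simplices`, so that `∑-mapMaybe` yields this expression
  -- directly.
  zeroExtend : Chain K p → Subset n → Bool
  zeroExtend c σ = maybe′ c false
    (Maybe.map (λ (σ∈K , d) → simplex σ σ∈K d) (dec⇒maybe (face? K σ ×-dec dim σ ℤ.≟ p)))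

  ∑-simplices : (c : Chain K p) → ∑ (simplices K p) c ≡ ∑ (subsets n) (zeroExtend c)
  ∑-simplices c = ∑-mapMaybe _ (subsets n) c

  face : (σ : Simplex K p) → verts σ ∈ Face K
  face (simplex σ σ∈K _) = recompute (face? K σ) σ∈K

  dim≡ : (σ : Simplex K p) → dim (verts σ) ≡ p
  dim≡ (simplex σ _ d) = recompute (dim σ ℤ.≟ p) d

  -- Lets a formula that makes sense for every subset replace the padded chain: `supp` makes it
  -- vanish wherever the padding does.
  zeroExtend-unique : (c : Chain K p) (f : Subset n → Bool) → (∀ σ → f (verts σ) ≡ c σ) →
    (∀ τ → f τ ≡ true → τ ∈ Face K × dim τ ≡ p) → f ≗ zeroExtend c
  zeroExtend-unique c f f≡c supp τ with face? K τ | dim τ ℤ.≟ p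
  ... | yes τ∈K | yes d = f≡c (simplex τ τ∈K d)
  ... | yes τ∈K | no ¬d = ¬-not (¬d ∘ proj₂ ∘ supp τ)
  ... | no  τ∉K | _     = ¬-not (τ∉K ∘ proj₁ ∘ supp τ)

  zeroExtend-verts : (c : Chain K p) (σ : Simplex K p) → zeroExtend c (verts σ) ≡ c σ
  zeroExtend-verts c σ with face? K (verts σ) | dim (verts σ) ℤ.≟ p
  ... | yes _   | yes _ = refl
  ... | yes _   | no ¬d = contradiction (dim≡ σ) ¬d
  ... | no  σ∉K | _     = contradiction (face σ) σ∉K

  zeroExtend-off : (c : Chain K p) (σ : Simplex K p) → (∀ τ → verts τ ≢ verts σ → c τ ≡ false) →
    ∀ τ → τ ≢ verts σ → zeroExtend c τ ≡ false
  zeroExtend-off c σ off τ τ≢σ with face? K τ | dim τ ℤ.≟ p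
  ... | yes τ∈K | yes d = off (simplex τ τ∈K d) τ≢σ
  ... | yes _   | no _  = refl
  ... | no  _   | _     = refl

  ∑-simplices-single : (c : Chain K p) (σ : Simplex K p) →
    (∀ τ → verts τ ≢ verts σ → c τ ≡ false) → ∑ (simplices K p) c ≡ c σ
  ∑-simplices-single c σ off = begin
    ∑ (simplices K p) c            ≡⟨ ∑-simplices c ⟩
    ∑ (subsets n) (zeroExtend c)   ≡⟨ ∑-subsets-single _ (verts σ) (zeroExtend-off c σ off) ⟩
    zeroExtend c (verts σ)         ≡⟨ zeroExtend-verts c σ ⟩
    c σ                            ∎
    where open ≡-Reasoning

  ⟦⟧-refl : (σ : Simplex K p) → ⟦ σ ⟧ σ ≡ true
  ⟦⟧-refl σ = ⌊⌋-true (verts σ ≟ₛ verts σ) refl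

  ⟦⟧-≢ : (σ τ : Simplex K p) → verts τ ≢ verts σ → ⟦ σ ⟧ τ ≡ false
  ⟦⟧-≢ σ τ τ≢σ = trans (isYes≗does (verts τ ≟ₛ verts σ)) (dec-false (verts τ ≟ₛ verts σ) τ≢σ)

module _ {K : Complex n} {p q : ℤ} where

  linear-cong : (f : Simplex K p → Chain K q) {c d : Chain K p} → c ≗ d → linear f c ≗ linear f d
  linear-cong f c≗d τ = ∑-cong (simplices K p) (λ σ → cong (_∧ f σ τ) (c≗d σ))

  linear-⊕ : (f : Simplex K p → Chain K q) (c d : Chain K p) →
    linear f (λ σ → c σ xor d σ) ≗ λ τ → linear f c τ xor linear f d τ
  linear-⊕ f c d τ = trans (∑-cong (simplices K p) (λ σ → ∧-distribʳ-xor (f σ τ) (c σ) (d σ)))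
                           (∑-xor (simplices K p) _ _)

  linear-vanish : (f : Simplex K p → Chain K q) (c : Chain K p) (τ : Simplex K q) →
    (∀ σ → c σ ≡ true → f σ τ ≡ false) → linear f c τ ≡ false
  linear-vanish f c τ h = ∑-zero (simplices K p) (λ σ → ∧-vanish (h σ))

  linear-∘ : ∀ {r} (g : Simplex K q → Chain K r) (f : Simplex K p → Chain K q) (c : Chain K p) →
    linear g (linear f c) ≗ linear (λ σ → linear g (f σ)) c
  linear-∘ g f c ρ = begin
    ∑ ys (λ τ → ∑ xs (λ σ → c σ ∧ f σ τ) ∧ g τ ρ)   ≡⟨ ∑-cong ys (λ τ → sym (∑-∧ʳ xs (g τ ρ) _)) ⟩
    ∑ ys (λ τ → ∑ xs (λ σ → (c σ ∧ f σ τ) ∧ g τ ρ)) ≡⟨ ∑-comm ys xs _ ⟩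
    ∑ xs (λ σ → ∑ ys (λ τ → (c σ ∧ f σ τ) ∧ g τ ρ)) ≡⟨ ∑-cong xs (λ σ → ∑-cong ys (λ τ → ∧-assoc (c σ) _ _)) ⟩
    ∑ xs (λ σ → ∑ ys (λ τ → c σ ∧ (f σ τ ∧ g τ ρ))) ≡⟨ ∑-cong xs (λ σ → ∑-∧ˡ ys (c σ) _) ⟩
    ∑ xs (λ σ → c σ ∧ ∑ ys (λ τ → f σ τ ∧ g τ ρ))   ∎
    where
    open ≡-Reasoning
    xs = simplices K p
    ys = simplices K q

-- The complex of chains

dim+1 : (σ : Subset n) → dim σ + 1ℤ ≡ + ∣ σ ∣
dim+1 σ = trans (ℤ.+-assoc (+ ∣ σ ∣) -1ℤ 1ℤ) (ℤ.+-identityʳ _)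

p≡p-1+1 : ∀ p → p ≡ p - 1ℤ + 1ℤ
p≡p-1+1 p = sym (trans (ℤ.+-assoc p _ 1ℤ) (ℤ.+-identityʳ p))

p≡p+1-1 : ∀ p → p ≡ p + 1ℤ - 1ℤ
p≡p+1-1 p = sym (trans (ℤ.+-assoc p 1ℤ _) (ℤ.+-identityʳ p))

+1-injective : ∀ {p q} → p + 1ℤ ≡ q + 1ℤ → p ≡ q
+1-injective {p} {q} eq = trans (p≡p+1-1 p) (trans (cong (_- 1ℤ) eq) (sym (p≡p+1-1 q)))

dim-suc : {σ τ : Subset n} → ∣ τ ∣ ≡ suc ∣ σ ∣ → dim τ ≡ dim σ + 1ℤ
dim-suc {σ = σ} eq rewrite eq = sym (dim+1 σ)

-- The strict inclusions give ∣ρ∣ < ∣τ∣ < ∣σ∣ = ∣ρ∣ + 2, which leaves one value for ∣τ∣.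
dim-between : {ρ τ σ : Subset n} → ρ ⊂ τ → τ ⊂ σ → dim σ ≡ dim ρ + 1ℤ + 1ℤ → dim τ ≡ dim ρ + 1ℤ
dim-between {ρ = ρ} {τ} {σ} ρ⊂τ τ⊂σ eq = dim-suc {σ = ρ} {τ} (ℕ.≤-antisym τ≤ (p⊂q⇒∣p∣<∣q∣ ρ⊂τ))
  where
  -- Since `dim` is the cardinality minus one, adding a further `1ℤ` to both sides gives an equation
  -- between natural numbers.
  ∣σ∣ : ∣ σ ∣ ≡ suc (∣ ρ ∣ ℕ.+ 1)
  ∣σ∣ = ℤ.+-injective (begin
    + ∣ σ ∣                       ≡⟨ dim+1 σ ⟨
    dim σ + 1ℤ                    ≡⟨ cong (_+ 1ℤ) eq ⟩
    dim ρ + 1ℤ + 1ℤ + 1ℤ          ≡⟨ cong (λ i → i + 1ℤ + 1ℤ) (dim+1 ρ) ⟩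
    + ∣ ρ ∣ + 1ℤ + 1ℤ             ≡⟨ ℤ.+-comm (+ ∣ ρ ∣ + 1ℤ) 1ℤ ⟩
    1ℤ + (+ ∣ ρ ∣ + 1ℤ)           ∎)
    where open ≡-Reasoning
  τ≤ : ∣ τ ∣ ℕ.≤ suc ∣ ρ ∣
  τ≤ = ℕ.≤-pred (subst (suc ∣ τ ∣ ℕ.≤_) (trans ∣σ∣ (cong suc (ℕ.+-comm ∣ ρ ∣ 1))) (p⊂q⇒∣p∣<∣q∣ τ⊂σ))

module _ {K : Complex n} where

  -- Every τ with ρ ⊂ τ ⊂ σ is a face of the middle dimension, so the sum may be
  -- taken over all subsets.
  ∑-between-even : ∀ {p q r} → q ≡ r + 1ℤ → p ≡ q + 1ℤ → (ρ : Simplex K r) (σ : Simplex K p) →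
    ∑ (simplices K q) (λ τ → ⌊ verts ρ ⊂? verts τ ⌋ ∧ ⌊ verts τ ⊂? verts σ ⌋) ≡ false
  ∑-between-even {r = r} refl refl ρ σ = begin
    ∑ (simplices K (r + 1ℤ)) (between ∘ verts)            ≡⟨ ∑-simplices {K = K} (between ∘ verts) ⟩
    ∑ (subsets n) (zeroExtend {K = K} (between ∘ verts))  ≡⟨ ∑-cong (subsets n) (zeroExtend-unique {K = K} (between ∘ verts) between (λ _ → refl) between-face) ⟨
    ∑ (subsets n) between                                 ≡⟨ ∑-open-interval-even (verts ρ) (verts σ) ⟩
    false                                                 ∎
    where
    open ≡-Reasoning
    between : Subset n → Bool
    between τ = ⌊ verts ρ ⊂? τ ⌋ ∧ ⌊ τ ⊂? verts σ ⌋
    between-face : ∀ τ → between τ ≡ true → τ ∈ Face K × dim τ ≡ r + 1ℤ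
    between-face τ eq with verts ρ ⊂? τ | τ ⊂? verts σ
    ... | yes ρ⊂τ | yes τ⊂σ =
      -- Closure asks for a non-empty τ; a vertex of ρ provides the witness.
      closed K (let (x , x∈ρ) = nonempty K (face ρ) in x , proj₁ ρ⊂τ x∈ρ) (proj₁ τ⊂σ) (face σ) ,
      trans (dim-between ρ⊂τ τ⊂σ (trans (dim≡ σ) (cong (λ i → i + 1ℤ + 1ℤ) (sym (dim≡ ρ)))))
            (cong (_+ 1ℤ) (dim≡ ρ))

-- Morse sequences

∣p∪⁅x⁆∣ : (p : Subset n) (x : Fin n) → x ∉ₛ p → ∣ p ∪ₛ ⁅ x ⁆ ∣ ≡ suc ∣ p ∣
∣p∪⁅x⁆∣ (outside ∷ p) zero    x∉p = cong (suc ∘ ∣_∣) (∪-identityʳ p)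
∣p∪⁅x⁆∣ (inside  ∷ p) zero    x∉p = contradiction here x∉p
∣p∪⁅x⁆∣ (outside ∷ p) (suc x) x∉p = ∣p∪⁅x⁆∣ p x (x∉p ∘ there)
∣p∪⁅x⁆∣ (inside  ∷ p) (suc x) x∉p = cong suc (∣p∪⁅x⁆∣ p x (x∉p ∘ there))

-- Adding to σ one vertex of τ outside σ gives a face that properly contains σ, and by freeness this
-- face is already τ.
freePair-dim : {K : Complex n} {σ τ : Subset n} → FreePair K σ τ → dim τ ≡ dim σ + 1ℤ
freePair-dim {K = K} {σ} {τ} free = dim-suc {σ = σ} {τ} (trans (cong ∣_∣ (sym σ∪x≡τ)) (∣p∪⁅x⁆∣ σ x x∉σ))
  where
  open FreePair free
  x = proj₁ (proj₂ proper)
  x∈τ = proj₁ (proj₂ (proj₂ proper))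
  x∉σ = proj₂ (proj₂ (proj₂ proper))
  x∈σ∪x : x ∈ₛ σ ∪ₛ ⁅ x ⁆
  x∈σ∪x = q⊆p∪q σ ⁅ x ⁆ (x∈⁅x⁆ x)
  σ∪x⊆τ : σ ∪ₛ ⁅ x ⁆ ⊆ τ
  σ∪x⊆τ y∈ with x∈p∪q⁻ σ ⁅ x ⁆ y∈
  ... | inj₁ y∈σ = proj₁ proper y∈σ
  ... | inj₂ y∈x rewrite x∈⁅y⁆⇒x≡y x y∈x = x∈τ
  σ∪x≡τ : σ ∪ₛ ⁅ x ⁆ ≡ τ
  σ∪x≡τ = only (closed K (x , x∈σ∪x) σ∪x⊆τ upper∈K)
               (λ eq → x∉σ (subst (x ∈ₛ_) eq x∈σ∪x)) (p⊆p∪q ⁅ x ⁆)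

classify : {K : Complex n} (W : MorseSequence K) → ∀ {σ} → σ ∈ Face K →
           σ ∈ Critical W ⊎ σ ∈ LowerRegular W ⊎ σ ∈ UpperRegular W
classify (start K≐∅) σ∈K = contradiction σ∈K (K≐∅ _)
classify (expand W σ τ (_ , _ , K∖στ⊆L)) {ρ} ρ∈K with σ ≟ₛ ρ | τ ≟ₛ ρ
... | yes σ≡ρ | _       = inj₂ (inj₁ (inj₂ σ≡ρ))
... | no  _   | yes τ≡ρ = inj₂ (inj₂ (inj₂ τ≡ρ))
... | no  σ≢ρ | no τ≢ρ with classify W (K∖στ⊆L (ρ∈K , [ σ≢ρ , τ≢ρ ]′))
...   | inj₁ c        = inj₁ c
...   | inj₂ (inj₁ l) = inj₂ (inj₁ (inj₁ l))
...   | inj₂ (inj₂ u) = inj₂ (inj₂ (inj₁ u))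
classify (fill W ν (_ , _ , K∖ν⊆L)) {ρ} ρ∈K with ν ≟ₛ ρ
... | yes ν≡ρ = inj₁ (inj₂ ν≡ρ)
... | no  ν≢ρ with classify W (K∖ν⊆L (ρ∈K , ν≢ρ))
...   | inj₁ c  = inj₁ (inj₁ c)
...   | inj₂ lu = inj₂ lu

upper⊆face : {K : Complex n} (W : MorseSequence K) → ∀ {τ} → τ ∈ UpperRegular W → τ ∈ Face K
upper⊆face (expand W σ τ (_    , L⊆K , _)) (inj₁ u)    = proj₁ (L⊆K (upper⊆face W u))
upper⊆face (expand W σ τ (free , _ , _))   (inj₂ refl) = FreePair.upper∈K free
upper⊆face (fill W ν (_ , L⊆K , _))        u           = proj₁ (L⊆K (upper⊆face W u))

lower⊆face : {K : Complex n} (W : MorseSequence K) → ∀ {σ} → σ ∈ LowerRegular W → σ ∈ Face K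
lower⊆face (expand W σ τ (_    , L⊆K , _)) (inj₁ l)    = proj₁ (L⊆K (lower⊆face W l))
lower⊆face (expand W σ τ (free , _ , _))   (inj₂ refl) = FreePair.lower∈K free
lower⊆face (fill W ν (_ , L⊆K , _))        l           = proj₁ (L⊆K (lower⊆face W l))

-- Acyclicity along a Morse sequence.

-- In the last expansion (σ, τ), τ is the only coface of σ, so the value at σ of
-- the boundary of z is z τ.
upper-acyclic : {K L : Complex n} (W : MorseSequence L) → (∀ {σ} → σ ∈ Face L → σ ∈ Face K) →
  ∀ {q r} → q ≡ r + 1ℤ → (z : Chain K q) →
  (∀ τ → z τ ≡ true → verts τ ∈ UpperRegular W) →
  (∀ (σ : Simplex K r) → verts σ ∈ LowerRegular W →
     ∑ (simplices K q) (λ τ → z τ ∧ ⌊ verts σ ⊂? verts τ ⌋) ≡ false) →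
  ∀ τ → z τ ≡ false
-- Nothing is upper regular in the empty sequence, so `supp τ` itself refutes `z τ ≡ true`.
upper-acyclic (start _)    L⊆K _ z supp ∂z τ = ¬-not (supp τ)
upper-acyclic (fill W ν (_ , L′⊆L , _)) L⊆K e z supp ∂z = upper-acyclic W (L⊆K ∘ proj₁ ∘ L′⊆L) e z supp ∂z
upper-acyclic {K = K} W⁺@(expand W σ τ (free , L′⊆L , _)) L⊆K {q} {r} e z supp ∂z =
  upper-acyclic W (L⊆K ∘ proj₁ ∘ L′⊆L) e z supp′ (λ ρ l → ∂z ρ (inj₁ l))
  where
  open FreePair free
  z-last : ∀ τ′ → verts τ′ ≡ τ → z τ′ ≡ false
  z-last τ′ refl = begin
    z τ′                                     ≡⟨ ∧-comm true (z τ′) ⟩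
    z τ′ ∧ true                              ≡⟨ cong (z τ′ ∧_) (⌊⌋-true (σ ⊂? τ) proper) ⟨
    z τ′ ∧ ⌊ σ ⊂? τ ⌋                        ≡⟨ ∑-simplices-single _ τ′ off ⟨
    ∑ (simplices K q) (λ τ → z τ ∧ ⌊ σ ⊂? verts τ ⌋) ≡⟨ ∂z (simplex σ (L⊆K lower∈K) dimσ) (inj₂ refl) ⟩
    false ∎
    where
    open ≡-Reasoning
    dimσ : dim σ ≡ r
    dimσ = +1-injective (trans (sym (freePair-dim free)) (trans (dim≡ τ′) e))
    -- A τ″ in z is upper regular, hence a face of the current L and not merely of K, so freeness in
    -- L applies to it.
    off : ∀ τ″ → verts τ″ ≢ τ → z τ″ ∧ ⌊ σ ⊂? verts τ″ ⌋ ≡ false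
    off τ″ τ″≢τ = ∧-vanish λ zt → ¬-not λ σ⊂? → let σ⊂τ″ = ⌊⌋-true⁻ (σ ⊂? verts τ″) σ⊂? in
      τ″≢τ (only (upper⊆face W⁺ (supp τ″ zt))
                 (λ eq → ⊂-irref (sym eq) σ⊂τ″) (proj₁ σ⊂τ″))
  -- Once z is zero at τ, its support consists of simplices that were upper regular before the
  -- expansion.
  supp′ : ∀ τ′ → z τ′ ≡ true → verts τ′ ∈ UpperRegular W
  supp′ τ′ zt with supp τ′ zt
  ... | inj₁ u   = u
  ... | inj₂ eq = contradiction (trans (sym zt) (z-last τ′ (sym eq))) (λ ())

-- When z vanishes before the expansion (σ, τ), σ is the only facet of τ that may
-- lie in z, so the value at τ of the coboundary of z is z σ.
lower-acyclic : {K L : Complex n} (W : MorseSequence L) → (∀ {σ} → σ ∈ Face L → σ ∈ Face K) →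
  ∀ {q r} → r ≡ q + 1ℤ → (z : Chain K q) →
  (∀ σ → verts σ ∈ Face L → z σ ≡ true → verts σ ∈ LowerRegular W) →
  (∀ (τ : Simplex K r) → verts τ ∈ UpperRegular W →
     ∑ (simplices K q) (λ σ → z σ ∧ ⌊ verts σ ⊂? verts τ ⌋) ≡ false) →
  ∀ σ → verts σ ∈ Face L → z σ ≡ false
lower-acyclic (start _) L⊆K _ z supp δz σ σ∈L = ¬-not (supp σ σ∈L)
-- A filling adds no lower regular simplex, so a σ in z already lies in the smaller complex.
lower-acyclic (fill W ν (_ , L′⊆L , _)) L⊆K e z supp δz σ σ∈L = false-if-true λ zσ →
  lower-acyclic W (L⊆K ∘ proj₁ ∘ L′⊆L) e z (λ ρ → supp ρ ∘ proj₁ ∘ L′⊆L) δz σ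
    (lower⊆face W (supp σ σ∈L zσ))
lower-acyclic {K = K} {L} (expand {L′} W σ τ (free , L′⊆L , _)) L⊆K {q} {r} e z supp δz = z-vanish
  where
  open FreePair free
  -- The induction hypothesis comes first, in contrast to `upper-acyclic`: δz at τ isolates z σ only
  -- once the other facets of τ are known to miss z.
  z-before : ∀ ρ → verts ρ ∈ Face L′ → z ρ ≡ false
  z-before = lower-acyclic W (L⊆K ∘ proj₁ ∘ L′⊆L) e z supp′ (λ τ′ u → δz τ′ (inj₁ u))
    where
    supp′ : ∀ ρ → verts ρ ∈ Face L′ → z ρ ≡ true → verts ρ ∈ LowerRegular W
    supp′ ρ ρ∈L′ zρ with supp ρ (proj₁ (L′⊆L ρ∈L′)) zρ
    ... | inj₁ l   = l
    ... | inj₂ σ≡ρ = contradiction (inj₁ σ≡ρ) (proj₂ (L′⊆L ρ∈L′))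
  z-off : ∀ ρ → verts ρ ∈ Face L → verts ρ ≢ σ → z ρ ≡ false
  z-off ρ ρ∈L ρ≢σ = false-if-true λ zρ →
    [ z-before ρ ∘ lower⊆face W , (λ σ≡ρ → contradiction (sym σ≡ρ) ρ≢σ) ]′ (supp ρ ρ∈L zρ)
  z-last : ∀ ρ → verts ρ ≡ σ → z ρ ≡ false
  z-last ρ refl = begin
    z ρ               ≡⟨ ∧-comm true (z ρ) ⟩
    z ρ ∧ true        ≡⟨ cong (z ρ ∧_) (⌊⌋-true (σ ⊂? τ) proper) ⟨
    z ρ ∧ ⌊ σ ⊂? τ ⌋  ≡⟨ ∑-simplices-single _ ρ off ⟨
    ∑ (simplices K q) (λ ρ → z ρ ∧ ⌊ verts ρ ⊂? τ ⌋) ≡⟨ δz (simplex τ (L⊆K upper∈K) dimτ) (inj₂ refl) ⟩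
    false             ∎
    where
    open ≡-Reasoning
    dimτ : dim τ ≡ r
    dimτ = trans (freePair-dim free) (trans (cong (_+ 1ℤ) (dim≡ ρ)) (sym e))
    -- A proper non-empty face of τ lies in L by closure, so `z-off` covers it.
    off : ∀ ρ′ → verts ρ′ ≢ σ → z ρ′ ∧ ⌊ verts ρ′ ⊂? τ ⌋ ≡ false
    off ρ′ ρ′≢σ = trans (∧-comm (z ρ′) _) (∧-vanish λ ρ′⊂τ →
      z-off ρ′ (closed L (nonempty K (face ρ′)) (proj₁ (⌊⌋-true⁻ (verts ρ′ ⊂? τ) ρ′⊂τ)) upper∈K) ρ′≢σ)
  z-vanish : ∀ ρ → verts ρ ∈ Face L → z ρ ≡ false
  z-vanish ρ ρ∈L with verts ρ ≟ₛ σ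
  ... | yes ρ≡σ = z-last ρ ρ≡σ
  ... | no  ρ≢σ = z-off ρ ρ∈L ρ≢σ

-- The intertwining argument.

-- Both halves of the theorem are instances: D, V, R are the boundary, coreference
-- and reference maps with Lo, Up the lower and upper regular simplices, or the
-- coboundary, reference and coreference maps with Lo and Up exchanged.
module Intertwining
  {K : Complex n} (Crit Lo Up : Pred (Subset n) 0ℓ)
  (sort : ∀ {σ} → σ ∈ Face K → σ ∈ Crit ⊎ σ ∈ Lo ⊎ σ ∈ Up)
  (V R : ∀ {s} → Simplex K s → Chain K s)
  (V-crit : ∀ {s} (ν : Simplex K s) → verts ν ∈ Crit → V ν ≗ ⟦ ν ⟧)
  (V-lo : ∀ {s} (ν : Simplex K s) → verts ν ∈ Lo → V ν ≗ 𝟘)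
  (R-crit : ∀ {s} (ν : Simplex K s) → verts ν ∈ Crit → R ν ≗ ⟦ ν ⟧)
  (R-up : ∀ {s} (ν : Simplex K s) → verts ν ∈ Up → R ν ≗ 𝟘)
  where

  E : ∀ {s} → Simplex K s → Chain K s
  E κ ν = V ν κ

  -- V fixes ν, so in the transpose only the term κ = ν reaches ν.
  linear-E-crit : ∀ {s} (c : Chain K s) ν → verts ν ∈ Crit → linear E c ν ≡ c ν
  linear-E-crit c ν ν∈ = begin
    linear E c ν  ≡⟨ ∑-simplices-single (λ κ → c κ ∧ V ν κ) ν off ⟩
    c ν ∧ V ν ν   ≡⟨ cong (c ν ∧_) (trans (V-crit ν ν∈ ν) (⟦⟧-refl ν)) ⟩
    c ν ∧ true    ≡⟨ ∧-comm (c ν) true ⟩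
    c ν           ∎
    where
    open ≡-Reasoning
    off : ∀ κ → verts κ ≢ verts ν → c κ ∧ V ν κ ≡ false
    off κ κ≢ν = trans (cong (c κ ∧_) (trans (V-crit ν ν∈ κ) (⟦⟧-≢ ν κ κ≢ν))) (∧-zeroʳ (c κ))

  linear-E-lo : ∀ {s} (c : Chain K s) ν → verts ν ∈ Lo → linear E c ν ≡ false
  linear-E-lo c ν ν∈ = linear-vanish E c ν (λ κ _ → V-lo ν ν∈ κ)

  -- Critical simplices contribute only themselves, x has no simplex in `Lo`, and R kills those in
  -- `Up`.
  linear-R-crit : ∀ {s} (x : Chain K s) → (∀ μ → verts μ ∈ Lo → x μ ≡ false) →
    ∀ ν → verts ν ∈ Crit → linear R x ν ≡ x ν
  linear-R-crit x x-lo ν ν∈ = begin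
    linear R x ν  ≡⟨ ∑-simplices-single (λ μ → x μ ∧ R μ ν) ν off ⟩
    x ν ∧ R ν ν   ≡⟨ cong (x ν ∧_) (trans (R-crit ν ν∈ ν) (⟦⟧-refl ν)) ⟩
    x ν ∧ true    ≡⟨ ∧-comm (x ν) true ⟩
    x ν           ∎
    where
    open ≡-Reasoning
    off : ∀ μ → verts μ ≢ verts ν → x μ ∧ R μ ν ≡ false
    off μ μ≢ν with sort (face μ)
    ... | inj₁ crit      = trans (cong (x μ ∧_) (trans (R-crit μ crit ν) (⟦⟧-≢ μ ν (μ≢ν ∘ sym)))) (∧-zeroʳ (x μ))
    ... | inj₂ (inj₁ lo) = cong (_∧ R μ ν) (x-lo μ lo)
    ... | inj₂ (inj₂ up) = trans (cong (x μ ∧_) (R-up μ up ν)) (∧-zeroʳ (x μ))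

  -- D∘E vanishes on Lo: V vanishes on the transpose of D applied to Lo.
  linear-D∘E-lo : ∀ {s t} (D : Simplex K s → Chain K t) (σ : Simplex K t) →
    (∀ κ → ∑ (simplices K s) (λ τ → D τ σ ∧ V τ κ) ≡ false) →
    ∀ c → linear D (linear E c) σ ≡ false
  linear-D∘E-lo {s} D σ VDᵀ c = trans (linear-∘ D E c σ) (linear-vanish (λ κ → linear D (E κ)) c σ λ κ _ →
    trans (∑-cong (simplices K s) (λ τ → ∧-comm (V τ κ) (D τ σ))) (VDᵀ κ))

  -- `V-Dᵀ` and `V-D′ᵀ` are written as sums over the first index because the transpose of a boundary
  -- is a coboundary and conversely; this form fits both instances. The Morse sequence enters
  -- through `acyclic`.
  module _
    {p q r : ℤ} (D : Simplex K p → Chain K q) (D′ : Simplex K q → Chain K r)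
    (D′∘D : ∀ σ → linear D′ (D σ) ≗ 𝟘)
    (V-Dᵀ : ∀ σ → verts σ ∈ Lo → ∀ κ → ∑ (simplices K p) (λ τ → D τ σ ∧ V τ κ) ≡ false)
    (V-D′ᵀ : ∀ σ → verts σ ∈ Lo → ∀ κ → ∑ (simplices K q) (λ τ → D′ τ σ ∧ V τ κ) ≡ false)
    (R-D : ∀ τ → verts τ ∈ Up → linear R (D τ) ≗ 𝟘)
    (acyclic : ∀ z → (∀ τ → z τ ≡ true → verts τ ∈ Up) →
               (∀ σ → verts σ ∈ Lo → linear D′ z σ ≡ false) → z ≗ 𝟘)
    (c : Chain K p) (c-crit : ∀ κ → c κ ≡ true → verts κ ∈ Crit)
    where

    private
      u : Chain K p
      u σ = linear E c σ xor c σ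

      x y z : Chain K q
      x = linear D (linear E c)
      y = linear E (linear R x)
      z σ = x σ xor y σ

    u-crit : ∀ σ → verts σ ∈ Crit → u σ ≡ false
    u-crit σ crit = trans (cong (_xor c σ) (linear-E-crit c σ crit)) (xor-same (c σ))

    u-up : ∀ σ → u σ ≡ true → verts σ ∈ Up
    u-up σ uσ with sort (face σ)
    ... | inj₁ crit      = contradiction (trans (sym uσ) (u-crit σ crit)) (λ ())
    -- Here E c vanishes, so σ lies in c and is therefore critical as well; `u-crit` then gives the
    -- contradiction.
    ... | inj₂ (inj₁ lo) = contradiction (trans (sym uσ) (u-crit σ (c-crit σ cσ))) (λ ())
      where
      cσ : c σ ≡ true
      cσ = trans (sym (cong (_xor c σ) (linear-E-lo c σ lo))) uσ
    ... | inj₂ (inj₂ up) = up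

    R∘D∘E : linear R x ≗ linear R (linear D c)
    R∘D∘E κ = xor≡false⇒≡ (begin
      linear R x κ xor linear R (linear D c) κ       ≡⟨ linear-⊕ R x (linear D c) κ ⟨
      linear R (λ σ → x σ xor linear D c σ) κ        ≡⟨ linear-cong R (linear-⊕ D (linear E c) c) κ ⟨
      linear R (linear D u) κ                        ≡⟨ linear-∘ R D u κ ⟩
      linear (λ σ → linear R (D σ)) u κ              ≡⟨ linear-vanish (λ σ → linear R (D σ)) u κ (λ τ uτ → R-D τ (u-up τ uτ) κ) ⟩
      false                                          ∎)
      where open ≡-Reasoning

    x-lo : ∀ σ → verts σ ∈ Lo → x σ ≡ false
    x-lo σ lo = linear-D∘E-lo D σ (V-Dᵀ σ lo) c

    -- On `Crit`, y agrees with R x, which agrees with x because x misses `Lo`; on `Lo` both x and y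
    -- vanish.
    z-up : ∀ σ → z σ ≡ true → verts σ ∈ Up
    z-up σ zσ with sort (face σ)
    ... | inj₁ crit      = contradiction (trans (sym zσ) zσ≡0) (λ ())
      where
      zσ≡0 : z σ ≡ false
      zσ≡0 = trans (cong (x σ xor_) (trans (linear-E-crit _ σ crit) (linear-R-crit x x-lo σ crit))) (xor-same (x σ))
    ... | inj₂ (inj₁ lo) = contradiction (trans (sym zσ) (cong₂ _xor_ (x-lo σ lo) (linear-E-lo _ σ lo))) (λ ())
    ... | inj₂ (inj₂ up) = up

    -- The two summands vanish for different reasons: x is a D-image and D′ ∘ D = 0, while y is an
    -- E-image, which D′ sends to a chain missing `Lo`.
    D′z-lo : ∀ σ → verts σ ∈ Lo → linear D′ z σ ≡ false
    D′z-lo σ lo = trans (linear-⊕ D′ x y σ)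
      (cong₂ _xor_ (trans (linear-∘ D′ D (linear E c) σ) (linear-vanish (λ τ → linear D′ (D τ)) (linear E c) σ (λ τ _ → D′∘D τ σ)))
                   (linear-D∘E-lo D′ σ (V-D′ᵀ σ lo) _))

    intertwine : linear D (linear E c) ≗ linear E (linear R (linear D c))
    intertwine σ = trans (xor≡false⇒≡ (acyclic z z-up D′z-lo σ)) (linear-cong E R∘D∘E σ)

-- The two instances.

module _ {K : Complex n} (W : MorseSequence K) where

  -- The degrees are tied by an equation because `p - 1ℤ + 1ℤ` does not compute to `p`; the same is
  -- done for ⋏ below.
  coref-δ-lower′ : (⋎ : CoreferenceMap W) → ∀ {p q} → p ≡ q + 1ℤ → (σ : Simplex K q) → verts σ ∈ LowerRegular W →
    ∀ κ → ∑ (simplices K p) (λ τ → ⌊ verts σ ⊂? verts τ ⌋ ∧ chain (coref ⋎ τ) κ) ≡ false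
  coref-δ-lower′ ⋎ refl = coref-δ-lower ⋎

  ref-∂-upper′ : (⋏ : ReferenceMap W) → ∀ {p q} → q ≡ p - 1ℤ → (τ : Simplex K p) → verts τ ∈ UpperRegular W →
    ∀ κ → ∑ (simplices K q) (λ σ → ⌊ verts σ ⊂? verts τ ⌋ ∧ chain (ref ⋏ σ) κ) ≡ false
  ref-∂-upper′ ⋏ refl = ref-∂-upper ⋏

theorem9 : ∀ {n : ℕ} {K : Complex n} (W : MorseSequence K) (⋏ : ReferenceMap W) (⋎ : CoreferenceMap W) (p : ℤ) →
    (∀ (c : CriticalChain W p) → ∂ p (extension ⋎ p c) ≗ extension ⋎ (p - 1ℤ) (∂̂ ⋏ p c))
    × (∀ (c : CriticalChain W p) → δ p (coextension ⋏ p c) ≗ coextension ⋏ (p + 1ℤ) (δ̂ ⋎ p c))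
theorem9 {n} {K} W ⋏ ⋎ p = (λ c → Down.intertwine boundary boundary
      -- Composing boundaries descends from σ to ρ, so the two inclusions appear in the order
      -- opposite to `∑-between-even`.
      (λ σ ρ → trans (∑-cong (simplices K (p - 1ℤ)) (λ τ → ∧-comm ⌊ verts τ ⊂? verts σ ⌋ _))
                     (∑-between-even (p≡p-1+1 (p - 1ℤ)) (p≡p-1+1 p) ρ σ))
      (coref-δ-lower′ W ⋎ (p≡p-1+1 p))
      (coref-δ-lower′ W ⋎ (p≡p-1+1 (p - 1ℤ)))
      (ref-∂-upper ⋏)
      (upper-acyclic W (λ σ∈K → σ∈K) (p≡p-1+1 (p - 1ℤ)))
      (chain c) (support c))
  , (λ c → Up.intertwine coboundary coboundary
      (∑-between-even refl refl)
      (ref-∂-upper′ W ⋏ (p≡p+1-1 p))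
      (ref-∂-upper′ W ⋏ (p≡p+1-1 (p + 1ℤ)))
      (coref-δ-lower ⋎)
      -- For L = K every simplex is a face of L, so vanishing on L is vanishing everywhere.
      (λ z supp δz σ → lower-acyclic W (λ σ∈K → σ∈K) refl z (λ τ _ → supp τ) δz σ (face σ))
      (chain c) (support c))
  where
  module Down = Intertwining {K = K} (Critical W) (LowerRegular W) (UpperRegular W) (classify W)
    (λ σ → chain (coref ⋎ σ)) (λ σ → chain (ref ⋏ σ))
    (coref-critical ⋎) (coref-lower ⋎) (ref-critical ⋏) (ref-upper ⋏)
  module Up = Intertwining {K = K} (Critical W) (UpperRegular W) (LowerRegular W) (map₂ swap ∘ classify W)
    (λ σ → chain (ref ⋏ σ)) (λ σ → chain (coref ⋎ σ))
    (ref-critical ⋏) (ref-upper ⋏) (coref-critical ⋎) (coref-lower ⋎)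
  support : (c : CriticalChain W p) → ∀ κ → chain c κ ≡ true → verts κ ∈ Critical W
  support c κ cκ = critical c κ (Equivalence.from Bool.T-≡ cκ)
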